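{- Let $G$ be a finite connected simple graph with $|V(G)|\geq 3$ and $\gamma(G)=1$. Then $G$ is an ASR-graph if and only if there exists a (possibly null) finite simple graph $H$ (not necessarily connected) such that $G=K_3+H$ (up to isomorphism).
   Context: $\gamma(G)$ denotes the domination number of a finite simple graph $G$. For an edge $e=uv$ of $G$, $G-e$ is the graph obtained by deleting $e$, and $G_e$ is the graph obtained by subdividing $e$: delete $e$, add a new vertex $w$ and the edges $uw$ and $wv$. A finite connected simple graph $G$ of order at least two is an ASR-graph (anti-sub-removable graph) if $\gamma(G-e)\neq\gamma(G_e)$ for every edge $e$ of $G$. For vertex-disjoint graphs $G$ and $H$, the sum $G+H$ is the graph with vertex set $V(G)\cup V(H)$ and edge set $E(G)\cup E(H)\cup\{xy: x\in V(G),\ y\in V(H)\}$. The null graph is the graph with no vertices. -}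

module Defs where

open import Data.Empty using (⊥)
open import Data.Fin using (Fin; zero; suc; splitAt)
open import Data.Fin.Properties using (_≟_; all?; any?)
open import Data.Fin.Subset using (Subset; _∈_; _∉_; ∣_∣; ⊤)
open import Data.Fin.Subset.Properties using (_∈?_; ∈⊤; anySubset?)
open import Data.Nat using (ℕ; suc; _+_; _≤_; _<_; _<?_)
open import Data.Nat.Induction using (Acc; acc; <-wellFounded)
open import Data.Nat.Properties using (≮⇒≥)
open import Data.Product using (_×_; _,_; ∃; ∃-syntax; proj₁; proj₂)
open import Data.Sum using (_⊎_; inj₁; inj₂)
open import Data.Unit using (tt) renaming (⊤ to Unit)
open import Function using (_∘_; _↔_; _⇔_; Inverse)
open import Level using (0ℓ)
open import Relation.Binary using (Rel; Symmetric; Irreflexive; Decidable)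
open import Relation.Binary.Construct.Closure.ReflexiveTransitive using (Star)
open import Relation.Binary.PropositionalEquality using (_≡_; _≢_; refl; sym)
open import Relation.Nullary using (¬_; Dec; yes; no; ¬?; contradiction)
open import Relation.Nullary.Decidable using (_×-dec_; _⊎-dec_; _→-dec_)

-- A finite simple graph, with its vertices numbered.  Order 0 (the null
-- graph) is allowed.
record Graph : Set₁ where
  field
    order  : ℕ
    Adj    : Rel (Fin order) 0ℓ
    adj?   : Decidable Adj
    symm   : Symmetric Adj
    irrefl : Irreflexive _≡_ Adj

  Vertex : Set
  Vertex = Fin order

open Graph public

-- An edge with a chosen orientation: each edge uv occurs as uv and as vu, and
-- the constructions below do not depend on the choice.
record Edge (G : Graph) : Set where
  constructor edge
  field
    end₁   : Vertex G
    end₂   : Vertex G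
    joined : Adj G end₁ end₂

open Edge public

Connected : Graph → Set
Connected G = (x y : Vertex G) → Star (Adj G) x y

infix 4 _≅_

record _≅_ (G H : Graph) : Set where
  field
    vertices : Vertex G ↔ Vertex H
    adjacent : (x y : Vertex G) →
               Adj G x y ⇔ Adj H (Inverse.to vertices x) (Inverse.to vertices y)

Dominating : (G : Graph) → Subset (order G) → Set
Dominating G D = (x : Vertex G) → x ∉ D → ∃[ y ] (y ∈ D × Adj G x y)

IsDominationNumber : Graph → ℕ → Set
IsDominationNumber G k =
  (∃[ D ] (Dominating G D × ∣ D ∣ ≡ k)) ×
  ((D : Subset (order G)) → Dominating G D → k ≤ ∣ D ∣)

dominating? : (G : Graph) (D : Subset (order G)) → Dec (Dominating G D)
dominating? G D =
  all? λ x → ¬? (x ∈? D) →-dec any? λ y → (y ∈? D) ×-dec adj? G x y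

dominationNumber : (G : Graph) → ∃ (IsDominationNumber G)
dominationNumber G =
  descend ⊤ (λ x x∉⊤ → contradiction ∈⊤ x∉⊤) (<-wellFounded ∣ ⊤ {order G} ∣)
  where
  descend : (D : Subset (order G)) → Dominating G D → Acc _<_ ∣ D ∣ →
            ∃ (IsDominationNumber G)
  descend D dom (acc rec)
    with anySubset? (λ E → dominating? G E ×-dec (∣ E ∣ <? ∣ D ∣))
  ... | yes (E , domE , E<D) = descend E domE (rec E<D)
  ... | no none =
    ∣ D ∣ , (D , dom , refl) , λ E domE → ≮⇒≥ λ E<D → none (E , domE , E<D)

γ : Graph → ℕ
γ G = proj₁ (dominationNumber G)

γ-isDominationNumber : (G : Graph) → IsDominationNumber G (γ G)
γ-isDominationNumber G = proj₂ (dominationNumber G)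

-- {x , y} = {u , v} as unordered pairs.
SamePair : {A : Set} → A → A → A → A → Set
SamePair u v x y = (x ≡ u × y ≡ v) ⊎ (x ≡ v × y ≡ u)

samePair-sym : {A : Set} {u v x y : A} → SamePair u v x y → SamePair u v y x
samePair-sym (inj₁ (p , q)) = inj₂ (q , p)
samePair-sym (inj₂ (p , q)) = inj₁ (q , p)

delete : (G : Graph) → Edge G → Graph
delete G (edge u v _) = record
  { order  = order G
  ; Adj    = λ x y → Adj G x y × ¬ SamePair u v x y
  ; adj?   = λ x y → adj? G x y ×-dec
                     ¬? (((x ≟ u) ×-dec (y ≟ v)) ⊎-dec ((x ≟ v) ×-dec (y ≟ u)))
  ; symm   = λ (a , ne) → symm G a , ne ∘ samePair-sym
  ; irrefl = λ eq (a , _) → irrefl G eq a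
  }

-- The new vertex is zero; a vertex x of G becomes suc x.
SubdivideAdj : (G : Graph) → Edge G → Rel (Fin (suc (order G))) 0ℓ
SubdivideAdj G e zero    zero    = ⊥
SubdivideAdj G e zero    (suc y) = y ≡ end₁ e ⊎ y ≡ end₂ e
SubdivideAdj G e (suc x) zero    = x ≡ end₁ e ⊎ x ≡ end₂ e
SubdivideAdj G e (suc x) (suc y) = Adj (delete G e) x y

subdivide : (G : Graph) → Edge G → Graph
subdivide G e = record
  { order  = suc (order G)
  ; Adj    = SubdivideAdj G e
  ; adj?   = dec
  ; symm   = λ {x} {y} → symmetric x y
  ; irrefl = λ {x} → λ { refl → irreflexive x }
  }
  where
  dec : Decidable (SubdivideAdj G e)
  dec zero    zero    = no λ ()
  dec zero    (suc y) = (y ≟ end₁ e) ⊎-dec (y ≟ end₂ e)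
  dec (suc x) zero    = (x ≟ end₁ e) ⊎-dec (x ≟ end₂ e)
  dec (suc x) (suc y) = adj? (delete G e) x y

  symmetric : ∀ x y → SubdivideAdj G e x y → SubdivideAdj G e y x
  symmetric zero    (suc y) a = a
  symmetric (suc x) zero    a = a
  symmetric (suc x) (suc y) a = symm (delete G e) a

  irreflexive : ∀ x → ¬ SubdivideAdj G e x x
  irreflexive (suc x) a = irrefl (delete G e) refl a

IsASR : Graph → Set
IsASR G = 2 ≤ order G × Connected G ×
          ((e : Edge G) → γ (delete G e) ≢ γ (subdivide G e))

K : ℕ → Graph
K n = record
  { order  = n
  ; Adj    = _≢_
  ; adj?   = λ x y → ¬? (x ≟ y)
  ; symm   = λ x≢y → x≢y ∘ sym
  ; irrefl = λ eq x≢y → x≢y eq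
  }

SumAdj : (G H : Graph) → Rel (Vertex G ⊎ Vertex H) 0ℓ
SumAdj G H (inj₁ x) (inj₁ y) = Adj G x y
SumAdj G H (inj₁ x) (inj₂ y) = Unit
SumAdj G H (inj₂ x) (inj₁ y) = Unit
SumAdj G H (inj₂ x) (inj₂ y) = Adj H x y

infixl 6 _+ᴳ_

-- Vertices below order G are those of G; the remaining ones are those of H.
_+ᴳ_ : Graph → Graph → Graph
G +ᴳ H = record
  { order  = order G + order H
  ; Adj    = λ x y → SumAdj G H (split x) (split y)
  ; adj?   = λ x y → dec (split x) (split y)
  ; symm   = λ {x} {y} → symmetric (split x) (split y)
  ; irrefl = λ {x} → λ { refl → irreflexive (split x) }
  }
  where
  split : Fin (order G + order H) → Vertex G ⊎ Vertex H
  split = splitAt (order G)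

  dec : Decidable (SumAdj G H)
  dec (inj₁ x) (inj₁ y) = adj? G x y
  dec (inj₁ x) (inj₂ y) = yes tt
  dec (inj₂ x) (inj₁ y) = yes tt
  dec (inj₂ x) (inj₂ y) = adj? H x y

  symmetric : ∀ x y → SumAdj G H x y → SumAdj G H y x
  symmetric (inj₁ x) (inj₁ y) a = symm G a
  symmetric (inj₁ x) (inj₂ y) a = tt
  symmetric (inj₂ x) (inj₁ y) a = tt
  symmetric (inj₂ x) (inj₂ y) a = symm H a

  irreflexive : ∀ x → ¬ SumAdj G H x x
  irreflexive (inj₁ x) a = irrefl G refl a
  irreflexive (inj₂ x) a = irrefl H refl a

{-# OPTIONS --safe #-}
module Submission where

open import Defs
open import Data.Empty using (⊥-elim)
open import Data.Fin using
  (Fin; zero; suc; punchIn; punchOut; splitAt; join; _↑ˡ_; _↑ʳ_; inject≤)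
open import Data.Fin.Permutation using
  (Permutation; _⟨$⟩ʳ_; _⟨$⟩ˡ_; insert; insert-punchIn; inverseʳ)
open import Data.Fin.Properties using
  (_≟_; suc-injective; ↑ˡ-injective; inject≤-injective; join-splitAt; splitAt-↑ˡ;
   splitAt-↑ʳ; splitAt⁻¹-↑ˡ; punchIn-punchOut; punchOut-injective)
open import Data.Fin.Subset using (Subset; inside; outside; _∈_; ∣_∣; ⁅_⁆; _∪_)
open import Data.Fin.Subset.Properties using
  (_∈?_; p⊂q⇒∣p∣<∣q∣; x∈⁅x⁆; x∈⁅y⁆⇒x≡y; x≢y⇒x∉⁅y⁆; ∣⁅x⁆∣≡1; x∈p∪q⁺)
open import Data.Nat using (ℕ; suc; _+_; _≤_; _<_; s≤s; _≤?_)
open import Data.Nat.Properties using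
  (≤-refl; ≤-trans; ≤-reflexive; ≤-antisym; ≰⇒>; <⇒≱; n≤1+n; +-suc; module ≤-Reasoning)
open import Data.Product using (_×_; _,_; proj₁; proj₂; ∃; ∃-syntax)
open import Data.Sum using (_⊎_; inj₁; inj₂)
open import Data.Unit using (tt)
open import Data.Vec using ([]; _∷_)
open import Function using (_∘_; _⇔_; mk⇔; Equivalence; Inverse; Injection)
open import Function.Construct.Identity using (↔-id)
open import Function.Definitions using (Injective)
open import Function.Properties.Inverse using (↔⇒↣; ↔-sym)
open import Relation.Binary.PropositionalEquality using
  (_≡_; _≢_; refl; sym; trans; cong; subst; subst₂)
open import Relation.Nullary using (¬_; yes; no; contradiction)
open import Relation.Nullary.Decidable using (decidable-stable)

-- Call a vertex universal if it is adjacent to all others; γ ≤ 1 means that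
-- there is one.  If G has one and |V(G)| ≥ 3, then γ(G_e) = 2 for every edge e,
-- and γ(G - e) ≤ 2 with equality exactly when every universal vertex of G is
-- an end of e.  So G is ASR iff no edge covers all its universal vertices.
-- As universal vertices are adjacent to everything, this means that there are
-- at least three of them, that is, that K₃ splits off as a summand.

∣p∪q∣≤∣p∣+∣q∣ : ∀ {n} (p q : Subset n) → ∣ p ∪ q ∣ ≤ ∣ p ∣ + ∣ q ∣
∣p∪q∣≤∣p∣+∣q∣ []            []            = ≤-refl
∣p∪q∣≤∣p∣+∣q∣ (outside ∷ p) (outside ∷ q) = ∣p∪q∣≤∣p∣+∣q∣ p q
∣p∪q∣≤∣p∣+∣q∣ (outside ∷ p) (inside  ∷ q) =
  ≤-trans (s≤s (∣p∪q∣≤∣p∣+∣q∣ p q)) (≤-reflexive (sym (+-suc ∣ p ∣ ∣ q ∣)))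
∣p∪q∣≤∣p∣+∣q∣ (inside  ∷ p) (outside ∷ q) = s≤s (∣p∪q∣≤∣p∣+∣q∣ p q)
∣p∪q∣≤∣p∣+∣q∣ (inside  ∷ p) (inside  ∷ q) =
  s≤s (≤-trans (∣p∪q∣≤∣p∣+∣q∣ p q)
        (≤-trans (n≤1+n _) (≤-reflexive (sym (+-suc ∣ p ∣ ∣ q ∣)))))

-- If `x` and `y` differed, `⁅ x ⁆` would be a proper subset of `p`, forcing `∣ p ∣` above 1.
∣p∣≤1⇒unique : ∀ {n} {p : Subset n} {x y} → ∣ p ∣ ≤ 1 → x ∈ p → y ∈ p → x ≡ y
∣p∣≤1⇒unique {p = p} {x} {y} ∣p∣≤1 x∈p y∈p = decidable-stable (x ≟ y) λ x≢y →
  <⇒≱ (subst (_< ∣ p ∣) (∣⁅x⁆∣≡1 x) (p⊂q⇒∣p∣<∣q∣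
        ( (λ z∈⁅x⁆ → subst (_∈ p) (sym (x∈⁅y⁆⇒x≡y x z∈⁅x⁆)) x∈p)
        , y , y∈p , x≢y⇒x∉⁅y⁆ (x≢y ∘ sym))))
      ∣p∣≤1

injective-avoids-pair : ∀ {n} (f : Fin 3 → Fin n) → Injective _≡_ _≡_ f →
                        ∀ u v → ∃[ i ] (f i ≢ u × f i ≢ v)
injective-avoids-pair f inj u v
  with f zero ≟ u | f zero ≟ v | f (suc zero) ≟ u | f (suc zero) ≟ v
... | no ≢u    | no ≢v    | _        | _        = zero , ≢u , ≢v
... | _        | _        | no ≢u    | no ≢v    = suc zero , ≢u , ≢v
-- From here on the first two values both lie among `u` and `v`. If they coincide, injectivity
-- fails; otherwise they use up the pair, and the third value avoids it.
... | yes refl | _        | yes eq   | _        = contradiction (inj eq) λ ()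
... | _        | yes refl | _        | yes eq   = contradiction (inj eq) λ ()
... | yes refl | _        | _        | yes refl =
  suc (suc zero) , (λ eq → contradiction (inj eq) λ ()) , (λ eq → contradiction (inj eq) λ ())
... | _        | yes refl | yes refl | _        =
  suc (suc zero) , (λ eq → contradiction (inj eq) λ ()) , (λ eq → contradiction (inj eq) λ ())

avoid-pair : ∀ {n} → 3 ≤ n → (u v : Fin n) → ∃[ z ] (z ≢ u × z ≢ v)
avoid-pair 3≤n u v =
  let i , i≢u , i≢v = injective-avoids-pair
        (λ j → inject≤ j 3≤n) (inject≤-injective 3≤n 3≤n _ _) u v
  in inject≤ i 3≤n , i≢u , i≢v

-- Induction on `k`: `f zero` is punched out of the codomain, the remaining values are extended
-- there, and `f zero` is inserted back at position zero. As `m` comes out of the recursion, no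
-- subtraction enters the type.
injection-extends-to-permutation :
  ∀ {k n} (f : Fin k → Fin n) → Injective _≡_ _≡_ f →
  ∃[ m ] ∃ λ (π : Permutation (k + m) n) → ∀ i → π ⟨$⟩ʳ (i ↑ˡ m) ≡ f i
injection-extends-to-permutation {0} {n} f inj = n , ↔-id _ , λ ()
injection-extends-to-permutation {suc k} {0} f inj = contradiction (f zero) λ ()
injection-extends-to-permutation {suc k} {suc n} f inj =
  let m , π , π-extends = injection-extends-to-permutation
        (λ i → punchOut (f0≢ i)) (suc-injective ∘ inj ∘ punchOut-injective (f0≢ _) (f0≢ _))
  in m , insert zero (f zero) π , λ
    { zero    → refl
    ; (suc i) → trans (insert-punchIn zero (f zero) π (i ↑ˡ m))
                  (trans (cong (punchIn (f zero)) (π-extends i))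
                         (punchIn-punchOut (f0≢ i)))
    }
  where
  f0≢ : ∀ i → f zero ≢ f (suc i)
  f0≢ i eq = contradiction (inj eq) λ ()

Universal : (G : Graph) → Vertex G → Set
Universal G x = ∀ y → y ≢ x → Adj G y x

universal⇒γ≤1 : ∀ {G x} → Universal G x → γ G ≤ 1
universal⇒γ≤1 {G} {x} univ = subst (γ G ≤_) (∣⁅x⁆∣≡1 x)
  (proj₂ (γ-isDominationNumber G) ⁅ x ⁆ λ y y∉⁅x⁆ →
    x , x∈⁅x⁆ x , univ y λ { refl → y∉⁅x⁆ (x∈⁅x⁆ y) })

γ≤1⇒universal : ∀ {G} → Vertex G → γ G ≤ 1 → ∃ (Universal G)
γ≤1⇒universal {G} z γ≤1 with γ-isDominationNumber G
... | (D , dom , ∣D∣≡γ) , _ = centre , universal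
  where
  ∣D∣≤1 : ∣ D ∣ ≤ 1
  ∣D∣≤1 = subst (_≤ 1) (sym ∣D∣≡γ) γ≤1

  -- The given vertex `z` shows that `D` is nonempty: it lies in `D` or has a neighbour there.
  member : ∃ (_∈ D)
  member with z ∈? D
  ... | yes z∈D = z , z∈D
  ... | no  z∉D = let y , y∈D , _ = dom z z∉D in y , y∈D

  centre : Vertex G
  centre = proj₁ member

  universal : Universal G centre
  universal y y≢c
    with x , x∈D , yx ← dom y (λ y∈D → y≢c (∣p∣≤1⇒unique ∣D∣≤1 y∈D (proj₂ member)))
    = subst (Adj G y) (∣p∣≤1⇒unique ∣D∣≤1 x∈D (proj₂ member)) yx

dominatingPair⇒γ≤2 : ∀ {G} x y → (∀ z → z ≢ x → z ≢ y → Adj G z x ⊎ Adj G z y) → γ G ≤ 2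
dominatingPair⇒γ≤2 {G} x y dom = begin
  γ G                      ≤⟨ proj₂ (γ-isDominationNumber G) (⁅ x ⁆ ∪ ⁅ y ⁆) dominates ⟩
  ∣ ⁅ x ⁆ ∪ ⁅ y ⁆ ∣        ≤⟨ ∣p∪q∣≤∣p∣+∣q∣ ⁅ x ⁆ ⁅ y ⁆ ⟩
  ∣ ⁅ x ⁆ ∣ + ∣ ⁅ y ⁆ ∣    ≡⟨ cong (_+ ∣ ⁅ y ⁆ ∣) (∣⁅x⁆∣≡1 x) ⟩
  1 + ∣ ⁅ y ⁆ ∣            ≡⟨ cong (1 +_) (∣⁅x⁆∣≡1 y) ⟩
  2                        ∎
  where
  open ≤-Reasoning
  dominates : Dominating G (⁅ x ⁆ ∪ ⁅ y ⁆)
  dominates z z∉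
    with dom z (λ { refl → z∉ (x∈p∪q⁺ (inj₁ (x∈⁅x⁆ z))) })
               (λ { refl → z∉ (x∈p∪q⁺ {p = ⁅ x ⁆} (inj₂ (x∈⁅x⁆ z))) })
  ... | inj₁ zx = x , x∈p∪q⁺ (inj₁ (x∈⁅x⁆ x)) , zx
  ... | inj₂ zy = y , x∈p∪q⁺ {p = ⁅ x ⁆} (inj₂ (x∈⁅x⁆ y)) , zy

delete-universal : ∀ {G} {e : Edge G} {t} → t ≢ end₁ e → t ≢ end₂ e →
                   Universal G t → Universal (delete G e) t
delete-universal t≢u t≢v univ y y≢t =
  univ y y≢t , λ { (inj₁ (_ , t≡v)) → t≢v t≡v ; (inj₂ (_ , t≡u)) → t≢u t≡u }

delete-universal⁻ : ∀ {G} {e : Edge G} {t} → Universal (delete G e) t →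
                    Universal G t × t ≢ end₁ e × t ≢ end₂ e
delete-universal⁻ {G} {edge u v uv} univ =
    (λ y y≢t → proj₁ (univ y y≢t))
  -- If `t` were one end of the edge, the other end would be a different vertex no longer adjacent
  -- to it.
  , (λ { refl → proj₂ (univ v v≢u) (inj₂ (refl , refl)) })
  , (λ { refl → proj₂ (univ u (v≢u ∘ sym)) (inj₁ (refl , refl)) })
  where
  v≢u : v ≢ u
  v≢u refl = irrefl G refl uv

-- No vertex of the subdivision is universal. The new vertex is adjacent only to the two ends, and a
-- third vertex exists. An old vertex adjacent to the new one is an end of `e`, and it has lost the
-- other end.
subdivide-2≤γ : ∀ {G} → 3 ≤ order G → (e : Edge G) → 2 ≤ γ (subdivide G e)
subdivide-2≤γ {G} 3≤n e@(edge u v uv) with γ (subdivide G e) ≤? 1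
... | no  γ≰1 = ≰⇒> γ≰1
... | yes γ≤1 = ⊥-elim (no-universal _ (proj₂ (γ≤1⇒universal {subdivide G e} zero γ≤1)))
  where
  u≢v : u ≢ v
  u≢v refl = irrefl G refl uv

  no-universal : ∀ t → ¬ Universal (subdivide G e) t
  no-universal zero univ with avoid-pair 3≤n u v
  ... | z , z≢u , z≢v with univ (suc z) (λ ())
  ...   | inj₁ z≡u = z≢u z≡u
  ...   | inj₂ z≡v = z≢v z≡v
  no-universal (suc t) univ with univ zero (λ ())
  ... | inj₁ refl = proj₂ (univ (suc v) (u≢v ∘ sym ∘ suc-injective)) (inj₂ (refl , refl))
  ... | inj₂ refl = proj₂ (univ (suc u) (u≢v ∘ suc-injective)) (inj₁ (refl , refl))

module _ {G : Graph} (e : Edge G) (univ : Universal G (end₂ e)) where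

  private
    adj-end₂ : ∀ z → z ≢ end₂ e → z ≢ end₁ e → Adj (delete G e) z (end₂ e)
    adj-end₂ z z≢v z≢u =
      univ z z≢v , λ { (inj₁ (z≡u , _)) → z≢u z≡u ; (inj₂ (z≡v , _)) → z≢v z≡v }

  -- Deletion costs `end₂ e` only the neighbour `end₁ e`, so adding that vertex gives a dominating
  -- pair.
  delete-γ≤2 : γ (delete G e) ≤ 2
  delete-γ≤2 = dominatingPair⇒γ≤2 {delete G e} (end₂ e) (end₁ e)
    λ z z≢v z≢u → inj₁ (adj-end₂ z z≢v z≢u)

  -- The same pair works, since the new vertex is a neighbour of `end₂ e`.
  subdivide-γ≤2 : γ (subdivide G e) ≤ 2
  subdivide-γ≤2 = dominatingPair⇒γ≤2 {subdivide G e} (suc (end₂ e)) (suc (end₁ e)) λ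
    { zero    _   _   → inj₁ (inj₂ refl)
    ; (suc z) z≢v z≢u → inj₁ (adj-end₂ z (z≢v ∘ cong suc) (z≢u ∘ cong suc))
    }

-- An injection rather than a subset or a count, so that it extends to a numbering of all vertices
-- with the chosen ones first.
UniversalVertices : ℕ → Graph → Set
UniversalVertices k G =
  ∃ λ (f : Fin k → Vertex G) → Injective _≡_ _≡_ f × ∀ i → Universal G (f i)

-- Let `e` join `y` to `x`. If γ(G - e) exceeded 1, it would be 2, as γ(G_e) is, against ASR. So G -
-- e has a universal vertex; it is universal in `G` as well and is not an end of `e`.
ASR⇒another-universal : ∀ {G} → 3 ≤ order G → IsASR G →
                        ∀ {x} y → y ≢ x → Universal G x →
                        ∃[ t ] (Universal G t × t ≢ y × t ≢ x)
ASR⇒another-universal {G} 3≤n (_ , _ , asr) {x} y y≢x univ = another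
  where
  e : Edge G
  e = edge y x (univ y y≢x)

  another : ∃[ t ] (Universal G t × t ≢ y × t ≢ x)
  another with γ (delete G e) ≤? 1
  ... | yes γ≤1 =
    let t , univ-t = γ≤1⇒universal {delete G e} x γ≤1
    in t , delete-universal⁻ {G} {e} univ-t
  ... | no  γ≰1 = contradiction
    (trans (≤-antisym (delete-γ≤2 {G} e univ) (≰⇒> γ≰1))
           (≤-antisym (subdivide-2≤γ {G} 3≤n e) (subdivide-γ≤2 {G} e univ)))
    (asr e)

ASR⇒universalVertices : ∀ {G} → 3 ≤ order G → γ G ≡ 1 → IsASR G → UniversalVertices 3 G
ASR⇒universalVertices {G} 3≤n γ≡1 asr
  with a , univ-a ← γ≤1⇒universal {G} (inject≤ zero 3≤n) (≤-reflexive γ≡1)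
  -- Any vertex `y` other than `a` will do: the edge from `y` to `a` yields `b`, and then the edge
  -- from `b` to `a` yields `c`, distinct from both.
  with y , y≢a , _ ← avoid-pair 3≤n a a
  with b , univ-b , _ , b≢a ← ASR⇒another-universal 3≤n asr y y≢a univ-a
  with c , univ-c , c≢b , c≢a ← ASR⇒another-universal 3≤n asr b b≢a univ-a
  = f , injective , universal
  where
  f : Fin 3 → Vertex G
  f zero             = a
  f (suc zero)       = b
  f (suc (suc zero)) = c

  injective : Injective _≡_ _≡_ f
  injective {zero}           {zero}           _  = refl
  injective {zero}           {suc zero}       eq = contradiction (sym eq) b≢a
  injective {zero}           {suc (suc zero)} eq = contradiction (sym eq) c≢a
  injective {suc zero}       {zero}           eq = contradiction eq b≢a
  injective {suc zero}       {suc zero}       _  = refl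
  injective {suc zero}       {suc (suc zero)} eq = contradiction (sym eq) c≢b
  injective {suc (suc zero)} {zero}           eq = contradiction eq c≢a
  injective {suc (suc zero)} {suc zero}       eq = contradiction eq c≢b
  injective {suc (suc zero)} {suc (suc zero)} _  = refl

  universal : ∀ i → Universal G (f i)
  universal zero             = univ-a
  universal (suc zero)       = univ-b
  universal (suc (suc zero)) = univ-c

-- One of the three vertices is not an end of `e` and stays universal after the deletion, so γ(G -
-- e) ≤ 1 < 2 ≤ γ(G_e).
universalVertices⇒ASR : ∀ {G} → Connected G → 3 ≤ order G → UniversalVertices 3 G → IsASR G
universalVertices⇒ASR {G} conn 3≤n (f , inj , univ) =
  ≤-trans (n≤1+n 2) 3≤n , conn , λ e eq →
    let i , i≢u , i≢v = injective-avoids-pair f inj (end₁ e) (end₂ e)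
        γ≤1 = universal⇒γ≤1 {delete G e} (delete-universal {G} {e} i≢u i≢v (univ i))
    in <⇒≱ (subdivide-2≤γ {G} 3≤n e) (subst (_≤ 1) eq γ≤1)

-- With the chosen vertices numbered first, the others induce `H`. Universality supplies every edge
-- within the first block and between the two blocks.
universalVertices⇒sum : ∀ {k G} → UniversalVertices k G → ∃[ H ] G ≅ K k +ᴳ H
universalVertices⇒sum {k} {G} (f , inj , univ)
  with m , π , π-extends ← injection-extends-to-permutation f inj
  = H , record
    -- `π` sends positions to vertices, hence the inverse. Adjacency is compared on positions and
    -- carried over to `x` and `y` by the round trip `position-split`.
    { vertices = ↔-sym π
    ; adjacent = λ x y → subst₂ (λ x′ y′ → Adj G x′ y′ ⇔ Adj (K k +ᴳ H) (π ⟨$⟩ˡ x) (π ⟨$⟩ˡ y))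
        (position-split x) (position-split y)
        (adjacent (splitAt k (π ⟨$⟩ˡ x)) (splitAt k (π ⟨$⟩ˡ y)))
    }
  where
  H : Graph
  H = record
    { order  = m
    ; Adj    = λ i j → Adj G (π ⟨$⟩ʳ (k ↑ʳ i)) (π ⟨$⟩ʳ (k ↑ʳ j))
    ; adj?   = λ i j → adj? G (π ⟨$⟩ʳ (k ↑ʳ i)) (π ⟨$⟩ʳ (k ↑ʳ j))
    ; symm   = symm G
    ; irrefl = λ { refl → irrefl G refl }
    }

  position : Fin k ⊎ Fin m → Vertex G
  position s = π ⟨$⟩ʳ join k m s

  position-split : ∀ x → position (splitAt k (π ⟨$⟩ˡ x)) ≡ x
  position-split x = trans (cong (π ⟨$⟩ʳ_) (join-splitAt k m (π ⟨$⟩ˡ x))) (inverseʳ π)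

  universal-↑ˡ : ∀ i → Universal G (position (inj₁ i))
  universal-↑ˡ i = subst (Universal G) (sym (π-extends i)) (univ i)

  position-injective : Injective _≡_ _≡_ (position ∘ inj₁)
  position-injective {i} {j} = ↑ˡ-injective m i j ∘ Injection.injective (↔⇒↣ π)

  position-disjoint : ∀ i j → position (inj₂ j) ≢ position (inj₁ i)
  position-disjoint i j eq
    -- `splitAt` puts the two positions on different sides of the disjoint union.
    with () ← trans (sym (splitAt-↑ʳ k m j))
                (trans (cong (splitAt k) (Injection.injective (↔⇒↣ π) eq)) (splitAt-↑ˡ k i m))

  adjacent : ∀ s t → Adj G (position s) (position t) ⇔ SumAdj (K k) H s t
  adjacent (inj₁ i) (inj₁ j) = mk⇔
    (λ { ij refl → irrefl G refl ij })
    (λ i≢j → universal-↑ˡ j _ (i≢j ∘ position-injective))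
  adjacent (inj₁ i) (inj₂ j) = mk⇔ (λ _ → tt)
    (λ _ → symm G (universal-↑ˡ i _ (position-disjoint i j)))
  adjacent (inj₂ i) (inj₁ j) = mk⇔ (λ _ → tt)
    (λ _ → universal-↑ˡ j _ (position-disjoint j i))
  adjacent (inj₂ i) (inj₂ j) = mk⇔ (λ ij → ij) (λ ij → ij)

-- Distinct vertices of `K k` are adjacent, and the sum joins each of them to all of `H`.
complete-summand-universal : ∀ k H (i : Fin k) → Universal (K k +ᴳ H) (i ↑ˡ order H)
complete-summand-universal k H i y y≢i rewrite splitAt-↑ˡ k i (order H)
  with splitAt k y in eq
... | inj₁ j = λ { refl → y≢i (sym (splitAt⁻¹-↑ˡ eq)) }
... | inj₂ _ = tt

≅-universal : ∀ {G H} (iso : G ≅ H) {x} → Universal H x →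
              Universal G (Inverse.from (_≅_.vertices iso) x)
≅-universal {G} {H} iso {x} univ y y≢ = Equivalence.from (adjacent y (from x))
  (subst (Adj H (to y)) (sym (strictlyInverseˡ x))
    (univ (to y) λ { refl → y≢ (sym (strictlyInverseʳ y)) }))
  where
  open _≅_ iso
  open Inverse vertices

sum⇒universalVertices : ∀ {k G H} → G ≅ K k +ᴳ H → UniversalVertices k G
sum⇒universalVertices {k} {G} {H} iso =
    (λ i → Inverse.from (_≅_.vertices iso) (i ↑ˡ order H))
  , ↑ˡ-injective (order H) _ _ ∘ Injection.injective (↔⇒↣ (↔-sym (_≅_.vertices iso)))
  , λ i → ≅-universal iso (complete-summand-universal k H i)

theorem13 : (G : Graph) → Connected G → 3 ≤ order G → γ G ≡ 1 →
    IsASR G ⇔ (∃[ H ] G ≅ K 3 +ᴳ H)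
theorem13 G conn 3≤n γ≡1 = mk⇔
  (λ asr → universalVertices⇒sum {G = G} (ASR⇒universalVertices {G} 3≤n γ≡1 asr))
  (λ (H , iso) → universalVertices⇒ASR {G} conn 3≤n (sum⇒universalVertices {H = H} iso))
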